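{- Given two lists $\{\alpha_i\}_{i\in[n]}$ and $\{\beta_i\}_{i\in[n]}$ of vectors $\alpha_i,\beta_i\in\{0,1\}^d$, one can construct in time $O(nd)$ two sequences of points $P_1$ and $P_2$ such that $\mathrm{DTWD}(P_1,P_2)=0$ if there are two vectors $\alpha_i$ and $\beta_j$ that are orthogonal, and $\mathrm{DTWD}(P_1,P_2)=1$ otherwise. The points of the sequences come from a pointset with a constant number of points (independent of $n$ and $d$), with a distance function $f$ between points that does not satisfy the triangle inequality.
   Context: $[n]=\{1,\dots,n\}$. Vectors $\alpha,\beta\in\{0,1\}^d$ are orthogonal if $\sum_{h=1}^d\alpha[h]\beta[h]=0$. Dynamic time warping distance: let $x,y$ be two finite sequences of points (possibly of different lengths) from a set equipped with a nonnegative distance function $f$. A traversal of $x$ and $y$ uses two markers, initially placed at the first points of $x$ and of $y$. At every step one marker or both markers simultaneously move one point forward in their sequences; at the end both markers must be at the last points of their sequences. The cost of a traversal is the sum of $f(s,t)$ over all configurations occurring in the traversal (the initial one included), where $s$ and $t$ are the points the two markers point at. $\mathrm{DTWD}(x,y)$ is the minimum cost of a traversal. -}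

module Defs where

open import Data.Fin.Base using (Fin; toℕ)
open import Data.List.Base using (List; []; _∷_; _++_; _ʳ++_; [_]; map; replicate; concatMap)
open import Data.List.NonEmpty.Base using (List⁺; _∷_; toList)
open import Data.Maybe.Base using (Maybe; just; nothing)
open import Data.Nat.Base using (ℕ; suc; _+_; _*_; _≤_)
open import Data.Product.Base using (_×_; _,_; ∃; ∃₂)
open import Data.Vec.Base as Vec using (Vec; []; _∷_; lookup)
open import Function.Metric.Nat.Core using (DistanceFunction)
open import Function.Metric.Nat.Definitions using (Symmetric)
open import Function.Metric.Nat.Structures using (IsPreMetric)
open import Relation.Binary.PropositionalEquality.Core using (_≡_)

------------------------------------------------------------------------
-- Orthogonal 0/1 vectors

BitVec : ℕ → Set
BitVec d = Vec (Fin 2) d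

Orthogonal : ∀ {d} → BitVec d → BitVec d → Set
Orthogonal a b = Vec.sum (Vec.zipWith (λ x y → toℕ x * toℕ y) a b) ≡ 0

OrthogonalPair : ∀ {n d} → Vec (BitVec d) n → Vec (BitVec d) n → Set
OrthogonalPair α β = ∃₂ λ i j → Orthogonal (lookup α i) (lookup β j)

------------------------------------------------------------------------
-- Dynamic time warping distance

-- Distinct points may be at distance 0 and the triangle inequality is not
-- required.
record IsDistance {A : Set} (f : DistanceFunction A) : Set where
  field
    isPreMetric : IsPreMetric _≡_ f
    sym         : Symmetric f

-- The two indices are the parts of the sequences from the current marker
-- positions onwards, so their heads are the points currently marked.
data Traversal {A : Set} : List⁺ A → List⁺ A → Set where
  end        : ∀ {s t} → Traversal (s ∷ []) (t ∷ [])
  moveFirst  : ∀ {s s′ t xs ys} → Traversal (s′ ∷ xs) (t ∷ ys) →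
               Traversal (s ∷ (s′ ∷ xs)) (t ∷ ys)
  moveSecond : ∀ {s t t′ xs ys} → Traversal (s ∷ xs) (t′ ∷ ys) →
               Traversal (s ∷ xs) (t ∷ (t′ ∷ ys))
  moveBoth   : ∀ {s s′ t t′ xs ys} → Traversal (s′ ∷ xs) (t′ ∷ ys) →
               Traversal (s ∷ (s′ ∷ xs)) (t ∷ (t′ ∷ ys))

cost : ∀ {A : Set} (f : DistanceFunction A) {x y} → Traversal x y → ℕ
cost f (end        {s} {t})   = f s t
cost f (moveFirst  {s} {t = t} T) = f s t + cost f T
cost f (moveSecond {s} {t} T) = f s t + cost f T
cost f (moveBoth   {s} {t = t} T) = f s t + cost f T

-- DTWD(x,y) = v: the value v is attained and is a lower bound.
IsDTWD : ∀ {A : Set} → DistanceFunction A → List⁺ A → List⁺ A → ℕ → Set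
IsDTWD f x y v = (∃ λ (T : Traversal x y) → cost f T ≡ v)
               × (∀ (T : Traversal x y) → v ≤ cost f T)

------------------------------------------------------------------------
-- Deterministic multitape Turing machines

data Move : Set where
  left right stay : Move

-- A two-way infinite tape; cells beyond either list are blank, and `before`
-- is stored nearest cell first.
record Tape (Γ : Set) : Set where
  constructor tape
  field
    before : List Γ
    under  : Γ
    after  : List Γ

module _ {Γ : Set} (blank : Γ) where

  emptyTape : Tape Γ
  emptyTape = tape [] blank []

  load : List Γ → Tape Γ
  load []       = emptyTape
  load (x ∷ xs) = tape [] x xs

  moveHead : Move → Tape Γ → Tape Γ
  moveHead stay  τ                     = τ
  moveHead left  (tape []       x ys) = tape [] blank (x ∷ ys)
  moveHead left  (tape (z ∷ zs) x ys) = tape zs z (x ∷ ys)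
  moveHead right (tape zs x [])       = tape (x ∷ zs) blank []
  moveHead right (tape zs x (y ∷ ys)) = tape (x ∷ zs) y ys

  writeAndMove : Tape Γ → Γ × Move → Tape Γ
  writeAndMove (tape zs _ ys) (x , m) = moveHead m (tape zs x ys)

  -- Apart from blanks at both ends, the tape content is w.
  Contains : Tape Γ → List Γ → Set
  Contains (tape zs x ys) w =
    ∃₂ λ p q → zs ʳ++ (x ∷ ys) ≡ replicate p blank ++ w ++ replicate q blank

-- k tapes and finitely many states; an undefined transition means halting.
-- Γ is to be instantiated by a finite type.
record Machine (Γ : Set) (k : ℕ) : Set where
  field
    states : ℕ
    start  : Fin states
    δ      : Fin states → Vec Γ k → Maybe (Fin states × Vec (Γ × Move) k)

module _ {Γ : Set} (blank : Γ) {k : ℕ} (M : Machine Γ k) where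
  open Machine M

  Config : Set
  Config = Fin states × Vec (Tape Γ) k

  step : Config → Maybe Config
  step (q , τs) with δ q (Vec.map Tape.under τs)
  ... | nothing        = nothing
  ... | just (q′ , as) = just (q′ , Vec.zipWith (writeAndMove blank) τs as)

  -- Run c t c′: started in c, the machine halts in c′ after exactly t steps.
  data Run : Config → ℕ → Config → Set where
    halted : ∀ {c} → step c ≡ nothing → Run c 0 c
    _then_ : ∀ {c c′ c″ t} → step c ≡ just c′ → Run c′ t c″ → Run c (suc t) c″

------------------------------------------------------------------------
-- Machines mapping two lists of 0/1 vectors to two sequences of points

-- For m points and a auxiliary symbols.
data Symbol (m a : ℕ) : Set where
  blank : Symbol m a
  sep   : Symbol m a
  bit   : Fin 2 → Symbol m a
  point : Fin m → Symbol m a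
  aux   : Fin a → Symbol m a

encode : ∀ {m a n d} → Vec (BitVec d) n → List (Symbol m a)
encode α = concatMap (λ v → map bit (Vec.toList v) ++ [ sep ]) (Vec.toList α)

-- Two input tapes, two output tapes and w further work tapes.
Transducer : (m a w : ℕ) → Set
Transducer m a w = Machine (Symbol m a) (4 + w)

-- M, given the lists α and β, halts after t steps having written P₁ and P₂.
Constructs : ∀ {m a w n d} → Transducer m a w →
             Vec (BitVec d) n → Vec (BitVec d) n →
             List⁺ (Fin m) → List⁺ (Fin m) → ℕ → Set
Constructs {w = w} M α β P₁ P₂ t =
  ∃ λ q → ∃₂ λ i₁ i₂ → ∃₂ λ o₁ o₂ → ∃ λ ws →
    Run blank M
      (Machine.start M , load blank (encode α) ∷ load blank (encode β)
                       ∷ Vec.replicate (2 + w) (emptyTape blank))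
      t
      (q , i₁ ∷ i₂ ∷ o₁ ∷ o₂ ∷ ws)
    × Contains blank o₁ (map point (toList P₁))
    × Contains blank o₂ (map point (toList P₂))

{-# OPTIONS --safe #-}
-- A traversal of cost 0 is a free path, one all of whose configurations are at
-- distance 0. The first sequence has a guarded block  enter, mark, a[1], link,
-- …, a[d], link, leave  per vector; the second is  wild, enter, then an unguarded
-- block  mark, b[1], link, …, b[d], link  per vector, then leave, wild. Since
-- `wild` is at distance 0 from everything, a free path may run to any `enter` of
-- the first sequence, and stay there until it reaches any `mark` of the second.
-- It has to get to `leave` before the second sequence does, and as delimiters
-- alternate with bits it must pass the two vectors in lockstep; bits x and y are
-- at distance x y, so the vectors are orthogonal. Exhausting the first sequence
-- while waiting at the initial `wild` costs only f(leave, enter) = 1 in total.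
module Submission where

open import Defs
open import Data.Bool.Base using (Bool; true; false; if_then_else_; _xor_)
open import Data.Empty using (⊥-elim)
open import Data.Fin.Base using (Fin; zero; suc; toℕ; _↑ˡ_; _↑ʳ_)
open import Data.Fin.Properties using (all?)
open import Data.List.Base using (List; []; _∷_; _++_; _ʳ++_; [_]; map)
open import Data.List.NonEmpty.Base as List⁺ using (List⁺; _∷_)
open import Data.List.Properties using (++-assoc; ʳ++-ʳ++)
open import Data.Maybe.Base using (Maybe; just; nothing)
open import Data.Nat.Base using (ℕ; zero; suc; _+_; _*_; _≤_; z≤n; s≤s)
open import Data.Nat.Properties
  using (_≟_; ≤-isPartialOrder; +-identityʳ; m+n≡0⇒m≡0; m+n≡0⇒n≡0; m≤m+n)
open import Data.Nat.Tactic.RingSolver using (solve-∀)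
open import Data.Product.Base using (_×_; _,_; Σ; ∃; ∃₂)
open import Data.Vec.Base as Vec using (Vec; []; _∷_; lookup)
open import Function.Metric.Nat.Core using (DistanceFunction)
open import Function.Metric.Nat.Definitions using (TriangleInequality)
open import Relation.Binary.PropositionalEquality
  using (_≡_; refl; sym; trans; cong; cong₂; subst₂; isEquivalence)
open import Relation.Nullary.Decidable.Core using (from-yes)
open import Relation.Nullary.Negation.Core using (¬_)

-- Dynamic time warping distance under a map of points

module _ {A B : Set} {f : DistanceFunction A} {g : DistanceFunction B} (h : A → B)
         (f≡g : ∀ s t → g (h s) (h t) ≡ f s t) where

  map-traversal : ∀ {x y} (T : Traversal x y) →
    ∃ λ (T′ : Traversal (List⁺.map h x) (List⁺.map h y)) → cost g T′ ≡ cost f T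
  map-traversal (end {s} {t}) = end , f≡g s t
  map-traversal (moveFirst {s} {t = t} T) with T′ , eq ← map-traversal T =
    moveFirst T′ , cong₂ _+_ (f≡g s t) eq
  map-traversal (moveSecond {s} {t} T) with T′ , eq ← map-traversal T =
    moveSecond T′ , cong₂ _+_ (f≡g s t) eq
  map-traversal (moveBoth {s} {t = t} T) with T′ , eq ← map-traversal T =
    moveBoth T′ , cong₂ _+_ (f≡g s t) eq

  -- The tails are split in every case because `List⁺.map h` must reduce before a move can be
  -- matched.
  unmap-traversal : ∀ x y (T : Traversal (List⁺.map h x) (List⁺.map h y)) →
    ∃ λ (T′ : Traversal x y) → cost g T ≡ cost f T′
  unmap-traversal (s ∷ [])     (t ∷ [])     end = end , f≡g s t
  unmap-traversal (s ∷ u ∷ xs) (t ∷ [])     (moveFirst T)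
    with T′ , eq ← unmap-traversal (u ∷ xs) (t ∷ []) T =
    moveFirst T′ , cong₂ _+_ (f≡g s t) eq
  unmap-traversal (s ∷ u ∷ xs) (t ∷ v ∷ ys) (moveFirst T)
    with T′ , eq ← unmap-traversal (u ∷ xs) (t ∷ v ∷ ys) T =
    moveFirst T′ , cong₂ _+_ (f≡g s t) eq
  unmap-traversal (s ∷ [])     (t ∷ v ∷ ys) (moveSecond T)
    with T′ , eq ← unmap-traversal (s ∷ []) (v ∷ ys) T =
    moveSecond T′ , cong₂ _+_ (f≡g s t) eq
  unmap-traversal (s ∷ u ∷ xs) (t ∷ v ∷ ys) (moveSecond T)
    with T′ , eq ← unmap-traversal (s ∷ u ∷ xs) (v ∷ ys) T =
    moveSecond T′ , cong₂ _+_ (f≡g s t) eq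
  unmap-traversal (s ∷ u ∷ xs) (t ∷ v ∷ ys) (moveBoth T)
    with T′ , eq ← unmap-traversal (u ∷ xs) (v ∷ ys) T =
    moveBoth T′ , cong₂ _+_ (f≡g s t) eq

  map-IsDTWD : ∀ {x y v} → IsDTWD f x y v → IsDTWD g (List⁺.map h x) (List⁺.map h y) v
  map-IsDTWD {x} {y} {v} ((T , T≡v) , v≤) with T′ , eq ← map-traversal T =
    (T′ , trans eq T≡v) , λ U → let U′ , eq′ = unmap-traversal x y U in
      subst₂ _≤_ refl (sym eq′) (v≤ U′)

-- Points and sequences

data Letter : Set where
  delim : Bool → Letter
  bit   : Fin 2 → Letter

pattern mark = delim true
pattern link = delim false

data Point : Set where
  wild enter leave : Point
  in₁ in₂          : Letter → Point

-- A bit never matches a delimiter, which forces two alternating words to be passed in step.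
-- Separating `mark` from `link` keeps a free path from entering a vector in the middle of a block.
clash : Letter → Letter → ℕ
clash (delim b) (delim c) = if b xor c then 1 else 0
clash (bit x)   (bit y)   = toℕ x * toℕ y
clash _         _         = 1

-- The first argument stands for the first sequence, the second for the second. Clauses with `in₂`
-- on the left or `in₁` on the right serve symmetry and a zero diagonal.
gap : Point → Point → ℕ
gap _       wild    = 0
gap wild    _       = 0
gap enter   enter   = 0
gap enter   leave   = 1
gap enter   (in₁ _) = 1
gap enter   (in₂ _) = 0
gap leave   enter   = 1
gap leave   leave   = 0
gap leave   (in₁ _) = 1
gap leave   (in₂ _) = 0
gap (in₁ _) enter   = 1
gap (in₁ _) leave   = 1
gap (in₁ _) (in₁ _) = 0
gap (in₁ b) (in₂ c) = clash b c
gap (in₂ _) enter   = 0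
gap (in₂ _) leave   = 0
gap (in₂ b) (in₁ c) = clash c b
gap (in₂ _) (in₂ _) = 0

letters : ∀ {d} → (Letter → Point) → BitVec d → List Point → List Point
letters i []      k = k
letters i (x ∷ a) k = i (bit x) ∷ i link ∷ letters i a k

blocks₁ : ∀ {n d} → Vec (BitVec d) n → List Point
blocks₁ []      = []
blocks₁ (a ∷ α) = enter ∷ in₁ mark ∷ letters in₁ a (leave ∷ blocks₁ α)

blocks₂ : ∀ {n d} → Vec (BitVec d) n → List Point
blocks₂ []      = leave ∷ wild ∷ []
blocks₂ (b ∷ β) = in₂ mark ∷ letters in₂ b (blocks₂ β)

-- The leading `leave` keeps the first sequence nonempty when there is no vector.
sequence₁ sequence₂ : ∀ {n d} → Vec (BitVec d) n → List⁺ Point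
sequence₁ α = leave ∷ blocks₁ α
sequence₂ β = wild ∷ enter ∷ blocks₂ β

-- Cheap traversals

Reach : List⁺ Point → List⁺ Point → ℕ → Set
Reach x y v = ∃ λ (T : Traversal x y) → cost gap T ≡ v

module _ {s t : Point} {xs ys : List Point} {v : ℕ} (s∼t : gap s t ≡ 0) where

  first : ∀ {u} → Reach (u ∷ xs) (t ∷ ys) v → Reach (s ∷ u ∷ xs) (t ∷ ys) v
  first (T , eq) = moveFirst T , cong₂ _+_ s∼t eq

  second : ∀ {u} → Reach (s ∷ xs) (u ∷ ys) v → Reach (s ∷ xs) (t ∷ u ∷ ys) v
  second (T , eq) = moveSecond T , cong₂ _+_ s∼t eq

  both : ∀ {u w} → Reach (u ∷ xs) (w ∷ ys) v → Reach (s ∷ u ∷ xs) (t ∷ w ∷ ys) v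
  both (T , eq) = moveBoth T , cong₂ _+_ s∼t eq

step₂ : ∀ {s xs u ys} t → Reach (s ∷ xs) (u ∷ ys) 0 → Reach (s ∷ xs) (t ∷ u ∷ ys) (gap s t)
step₂ {s} t (T , eq) = moveSecond T , trans (cong (gap s t +_) eq) (+-identityʳ _)

skip₁ : ∀ {d} (a : BitVec d) s {t xs ys v} → Reach (t ∷ xs) (wild ∷ ys) v →
        Reach (s ∷ letters in₁ a (t ∷ xs)) (wild ∷ ys) v
skip₁ []      s R = first refl R
skip₁ (x ∷ a) s R = first refl (first refl (skip₁ a (in₁ link) R))

-- The block ends in `link`, or in its opening letter when d = 0, so `R` has to start at any letter.
skip₂ : ∀ {d} (b : BitVec d) {s xs ys v} → (∀ c → gap s (in₂ c) ≡ 0) →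
        (∀ c → Reach (s ∷ xs) (in₂ c ∷ ys) v) →
        ∀ c → Reach (s ∷ xs) (in₂ c ∷ letters in₂ b ys) v
skip₂ []      near R c = R c
skip₂ (y ∷ b) near R c = second (near c) (second (near (bit y)) (skip₂ b near R link))

drain : ∀ {n d} (α : Vec (BitVec d) n) → Reach (leave ∷ blocks₁ α) (wild ∷ []) 0
drain []      = end , refl
drain (a ∷ α) = first refl (first refl (skip₁ a (in₁ mark) (drain α)))

-- Waiting at `leave` is free on every `in₂` letter and on the other `leave`; the final `wild` then
-- absorbs the rest of the first sequence. In `reach-1`, `t` is `enter`, the only configuration that
-- costs.
finish : ∀ {n n′ d} (α : Vec (BitVec d) n) (β : Vec (BitVec d) n′) t →
         Reach (leave ∷ blocks₁ α) (t ∷ blocks₂ β) (gap leave t)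
finish α []      t = step₂ t (second refl (drain α))
finish α (b ∷ β) t = step₂ t (skip₂ b (λ _ → refl) (λ c → finish α β (in₂ c)) mark)

reach-1 : ∀ {n n′ d} (α : Vec (BitVec d) n) (β : Vec (BitVec d) n′) →
          Reach (sequence₁ α) (sequence₂ β) 1
reach-1 []      β = second refl (finish [] β enter)
reach-1 (a ∷ α) β = first refl (first refl (skip₁ a (in₁ mark) (reach-1 α β)))

lockstep : ∀ {d} (a b : BitVec d) {xs ys} → Orthogonal a b →
           (∀ c → Reach (leave ∷ xs) (in₂ c ∷ ys) 0) →
           ∀ c → clash c c ≡ 0 →
           Reach (in₁ c ∷ letters in₁ a (leave ∷ xs)) (in₂ c ∷ letters in₂ b ys) 0
-- The first marker moves on to `leave` alone, while the second stays on the last letter of its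
-- block.
lockstep []      []      _   R c c∼c = first c∼c (R c)
lockstep (x ∷ a) (y ∷ b) a⊥b R c c∼c =
  both c∼c (both (m+n≡0⇒m≡0 _ a⊥b)
    (lockstep a b (m+n≡0⇒n≡0 (toℕ x * toℕ y) a⊥b) R link refl))

meet : ∀ {n n′ d} (a : BitVec d) (α : Vec (BitVec d) n) (β : Vec (BitVec d) n′) j →
       Orthogonal a (lookup β j) → ∀ t → gap enter t ≡ 0 →
       Reach (enter ∷ in₁ mark ∷ letters in₁ a (leave ∷ blocks₁ α)) (t ∷ blocks₂ β) 0
meet a α (b ∷ β) zero    a⊥b t e∼t =
  both e∼t (lockstep a b a⊥b (λ c → finish α β (in₂ c)) mark refl)
meet a α (b ∷ β) (suc j) a⊥b t e∼t =
  second e∼t (skip₂ b (λ _ → refl) (λ c → meet a α β j a⊥b (in₂ c) refl) mark)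

reach-0 : ∀ {n n′ d} (α : Vec (BitVec d) n) (β : Vec (BitVec d) n′) i j →
          Orthogonal (lookup α i) (lookup β j) → Reach (sequence₁ α) (sequence₂ β) 0
reach-0 (a ∷ α) β zero    j a⊥b = both refl (meet a α β j a⊥b enter refl)
reach-0 (a ∷ α) β (suc i) j a⊥b =
  first refl (first refl (skip₁ a (in₁ mark) (reach-0 α β i j a⊥b)))

-- Free traversals

Free : ∀ {x y} → Traversal x y → Set
Free T = cost gap T ≡ 0

start : ∀ {s xs t ys} (T : Traversal (s ∷ xs) (t ∷ ys)) → Free T → gap s t ≡ 0
start end            eq = eq
start (moveFirst T)  eq = m+n≡0⇒m≡0 _ eq
start (moveSecond T) eq = m+n≡0⇒m≡0 _ eq
start (moveBoth T)   eq = m+n≡0⇒m≡0 _ eq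

-- A single move, from two delimiters or from two bits, would pair a bit with a delimiter. So both
-- markers always move together, and each pair of bits has product 0.
locked : ∀ {d} (a b : BitVec d) c {xs ys}
         (T : Traversal (in₁ (delim c) ∷ letters in₁ a xs) (in₂ (delim c) ∷ letters in₂ b ys)) →
         Free T → Orthogonal a b
locked [] [] c T eq = refl
locked (x ∷ a) (y ∷ b) c (moveFirst T) eq
  with () ← start T (m+n≡0⇒n≡0 (clash (delim c) (delim c)) eq)
locked (x ∷ a) (y ∷ b) c (moveSecond T) eq
  with () ← start T (m+n≡0⇒n≡0 (clash (delim c) (delim c)) eq)
locked (x ∷ a) (y ∷ b) c (moveBoth T) eq
  with m+n≡0⇒n≡0 (clash (delim c) (delim c)) eq
locked (x ∷ a) (y ∷ b) c (moveBoth (moveFirst T)) _ | eq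
  with () ← start T (m+n≡0⇒n≡0 (toℕ x * toℕ y) eq)
locked (x ∷ a) (y ∷ b) c (moveBoth (moveSecond T)) _ | eq
  with () ← start T (m+n≡0⇒n≡0 (toℕ x * toℕ y) eq)
locked (x ∷ a) (y ∷ b) c (moveBoth (moveBoth T)) _ | eq =
  cong₂ _+_ (m+n≡0⇒m≡0 _ eq) (locked a b false T (m+n≡0⇒n≡0 (toℕ x * toℕ y) eq))

guarded : ∀ {d} → BitVec d → List Point → List⁺ Point
guarded a xs = enter ∷ in₁ mark ∷ letters in₁ a xs

-- Leaving `enter` before the last `link` would pair `in₁ mark` with a bit or a `link`. So the first
-- marker waits, and `κ` takes over at that last `link`.
pass₂ : ∀ {d e} (a : BitVec d) (b : BitVec e) y {xs ys} {P : Set} →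
        ((T : Traversal (guarded a xs) (in₂ link ∷ ys)) → Free T → P) →
        (T : Traversal (guarded a xs) (in₂ (bit y) ∷ in₂ link ∷ letters in₂ b ys)) → Free T → P
pass₂ a b        y κ (moveFirst T)               eq with () ← start T eq
pass₂ a b        y κ (moveBoth T)                eq with () ← start T eq
pass₂ a []       y κ (moveSecond T)              eq = κ T eq
pass₂ a (y′ ∷ b) y κ (moveSecond (moveFirst T))  eq with () ← start T eq
pass₂ a (y′ ∷ b) y κ (moveSecond (moveSecond T)) eq = pass₂ a b y′ κ T eq
pass₂ a (y′ ∷ b) y κ (moveSecond (moveBoth T))   eq with () ← start T eq

-- Here `t` is the point just before a block, `enter` or a last `link`: `in₁ mark` does not match
-- it, so the first marker cannot advance alone.
find : ∀ {n d} (a : BitVec d) (β : Vec (BitVec d) n) t {xs} →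
       gap enter t ≡ 0 → gap (in₁ mark) t ≡ 1 →
       (T : Traversal (guarded a xs) (t ∷ blocks₂ β)) → Free T → ∃ λ j → Orthogonal a (lookup β j)
find-mark : ∀ {n d} (a b : BitVec d) (β : Vec (BitVec d) n) {xs}
            (T : Traversal (guarded a xs) (in₂ mark ∷ letters in₂ b (blocks₂ β))) → Free T →
            ∃ λ j → Orthogonal a (lookup (b ∷ β) j)

find a []      t e∼t m≁t (moveFirst T)  eq rewrite e∼t with () ← trans (sym m≁t) (start T eq)
-- With no block left, the next point is `leave`, at distance 1 from both `enter` and `in₁ mark`.
find a []      t e∼t m≁t (moveSecond T) eq rewrite e∼t with () ← start T eq
find a []      t e∼t m≁t (moveBoth T)   eq rewrite e∼t with () ← start T eq
find a (b ∷ β) t e∼t m≁t (moveFirst T)  eq rewrite e∼t with () ← trans (sym m≁t) (start T eq)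
find a (b ∷ β) t e∼t m≁t (moveSecond T) eq rewrite e∼t = find-mark a b β T eq
find a (b ∷ β) t e∼t m≁t (moveBoth T)   eq rewrite e∼t = zero , locked a b true T eq

-- For d = 0 there is no `link` from which `find` could resume, but empty vectors are orthogonal.
find-mark []      []      β T              eq = zero , refl
find-mark (x ∷ a) (y ∷ b) β (moveFirst T)  eq = zero , locked (x ∷ a) (y ∷ b) true T eq
find-mark (x ∷ a) (y ∷ b) β (moveBoth T)   eq with () ← start T eq
find-mark (x ∷ a) (y ∷ b) β (moveSecond T) eq
  with j , a⊥b ← pass₂ (x ∷ a) b y (find (x ∷ a) β (in₂ link) refl refl) T eq = suc j , a⊥b

-- After the initial `wild` comes `enter`, at distance 1 from `leave` and from every `in₁` letter,
-- so the second marker cannot move during the block.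
pass₁ : ∀ {d} (a : BitVec d) c {xs ys} {P : Set} →
        ((T : Traversal (leave ∷ xs) (wild ∷ enter ∷ ys)) → Free T → P) →
        (T : Traversal (in₁ c ∷ letters in₁ a (leave ∷ xs)) (wild ∷ enter ∷ ys)) → Free T → P
pass₁ []      c κ (moveFirst T)  eq = κ T eq
pass₁ []      c κ (moveSecond T) eq with () ← start T eq
pass₁ []      c κ (moveBoth T)   eq with () ← start T eq
pass₁ (x ∷ a) c κ (moveSecond T) eq with () ← start T eq
pass₁ (x ∷ a) c κ (moveBoth T)   eq with () ← start T eq
pass₁ (x ∷ a) c κ (moveFirst (moveFirst T))  eq = pass₁ a link κ T eq
pass₁ (x ∷ a) c κ (moveFirst (moveSecond T)) eq with () ← start T eq
pass₁ (x ∷ a) c κ (moveFirst (moveBoth T))   eq with () ← start T eq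

free⇒orthogonal : ∀ {n n′ d} (α : Vec (BitVec d) n) (β : Vec (BitVec d) n′)
                  (T : Traversal (sequence₁ α) (sequence₂ β)) → Free T →
                  ∃₂ λ i j → Orthogonal (lookup α i) (lookup β j)
free⇒orthogonal []      β (moveSecond T) eq with () ← start T eq
free⇒orthogonal (a ∷ α) β (moveSecond T) eq with () ← start T eq
free⇒orthogonal (a ∷ α) β (moveBoth T)   eq = zero , find a β enter refl refl T eq
free⇒orthogonal (a ∷ α) β (moveFirst (moveSecond T)) eq = zero , find a β enter refl refl T eq
free⇒orthogonal (a ∷ α) β (moveFirst (moveBoth T))   eq with () ← start T eq
free⇒orthogonal (a ∷ α) β (moveFirst (moveFirst T))  eq
  with i , j , a⊥b ← pass₁ a mark (free⇒orthogonal α β) T eq = suc i , j , a⊥b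

-- The two values of the distance

module _ {n d : ℕ} (α β : Vec (BitVec d) n) where

  orthogonal⇒DTWD-0 : OrthogonalPair α β → IsDTWD gap (sequence₁ α) (sequence₂ β) 0
  orthogonal⇒DTWD-0 (i , j , a⊥b) = reach-0 α β i j a⊥b , λ _ → z≤n

  ¬orthogonal⇒DTWD-1 : ¬ OrthogonalPair α β → IsDTWD gap (sequence₁ α) (sequence₂ β) 1
  ¬orthogonal⇒DTWD-1 ¬⊥ = reach-1 α β , λ T → positive T (cost gap T) refl
    where
    positive : ∀ T v → cost gap T ≡ v → 1 ≤ v
    positive T zero    eq = ⊥-elim (¬⊥ (free⇒orthogonal α β T eq))
    positive T (suc v) eq = s≤s z≤n

-- The alphabet

index : Letter → Fin 4
index mark    = zero
index link    = suc zero
index (bit x) = 2 ↑ʳ x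

-- Three special points come first, then the four letters of `in₁`, then the four of `in₂`.
code : Point → Fin 11
code wild    = zero
code enter   = suc zero
code leave   = suc (suc zero)
code (in₁ c) = 3 ↑ʳ (index c ↑ˡ 4)
code (in₂ c) = 7 ↑ʳ index c

decode : Fin 11 → Point
decode = lookup
  (wild ∷ enter ∷ leave ∷
   in₁ mark ∷ in₁ link ∷ in₁ (bit zero) ∷ in₁ (bit (suc zero)) ∷
   in₂ mark ∷ in₂ link ∷ in₂ (bit zero) ∷ in₂ (bit (suc zero)) ∷ [])

decode-code : ∀ p → decode (code p) ≡ p
decode-code wild                   = refl
decode-code enter                  = refl
decode-code leave                  = refl
decode-code (in₁ mark)             = refl
decode-code (in₁ link)             = refl
decode-code (in₁ (bit zero))       = refl
decode-code (in₁ (bit (suc zero))) = refl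
decode-code (in₂ mark)             = refl
decode-code (in₂ link)             = refl
decode-code (in₂ (bit zero))       = refl
decode-code (in₂ (bit (suc zero))) = refl

dist : DistanceFunction (Fin 11)
dist i j = gap (decode i) (decode j)

dist-code : ∀ p q → dist (code p) (code q) ≡ gap p q
dist-code p q = cong₂ gap (decode-code p) (decode-code q)

dist-isDistance : IsDistance dist
dist-isDistance = record
  { isPreMetric = record
    { isProtoMetric = record
      { isPartialOrder  = ≤-isPartialOrder
      ; ≈-isEquivalence = isEquivalence
      ; cong            = cong₂ dist
      ; nonNegative     = z≤n
      }
    ; ≈⇒0 = λ { {i} refl → from-yes (all? λ i → dist i i ≟ 0) i }
    }
  ; sym = λ i j → from-yes (all? λ i → all? λ j → dist i j ≟ dist j i) i j
  }

¬dist-triangle : ¬ TriangleInequality dist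
-- Through `wild` the inequality would read 1 ≤ 0 + 0.
¬dist-triangle tri with () ← tri (code enter) (code wild) (code leave)

-- The machine

Γ : Set
Γ = Symbol 11 0

pattern s₀ = zero
pattern s₁ = suc zero
pattern s₂ = suc s₁
pattern s₃ = suc s₂
pattern s₄ = suc s₃
pattern s₅ = suc s₄
pattern s₆ = suc s₅
pattern s₇ = suc s₆

private
  put : Point → Γ × Move
  put p = point (code p) , right

  idle : Γ × Move
  idle = blank , stay

-- `s₀` and `s₁` write the opening points, `s₂` and `s₃` open a block, `s₄` and `s₅` alternate bits
-- and links. Both inputs have the same shape, so a blank on the first signals the end of both.
δ : Fin 8 → Vec Γ 4 → Maybe (Fin 8 × Vec (Γ × Move) 4)
δ s₀ (x ∷ y ∷ _) = just (s₁ , (x , stay) ∷ (y , stay) ∷ put leave ∷ put wild ∷ [])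
δ s₁ (x ∷ y ∷ _) = just (s₂ , (x , stay) ∷ (y , stay) ∷ idle ∷ put enter ∷ [])
δ s₂ (blank ∷ y ∷ _) = just (s₆ , idle ∷ (y , stay) ∷ idle ∷ put leave ∷ [])
δ s₂ (x ∷ y ∷ _) = just (s₃ , (x , stay) ∷ (y , stay) ∷ put enter ∷ idle ∷ [])
δ s₃ (x ∷ y ∷ _) = just (s₄ , (x , stay) ∷ (y , stay) ∷ put (in₁ mark) ∷ put (in₂ mark) ∷ [])
δ s₄ (bit x ∷ bit y ∷ _) =
  just (s₅ , (bit x , right) ∷ (bit y , right) ∷ put (in₁ (bit x)) ∷ put (in₂ (bit y)) ∷ [])
δ s₄ (x ∷ y ∷ _) = just (s₂ , (x , right) ∷ (y , right) ∷ put leave ∷ idle ∷ [])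
δ s₅ (x ∷ y ∷ _) = just (s₄ , (x , stay) ∷ (y , stay) ∷ put (in₁ link) ∷ put (in₂ link) ∷ [])
δ s₆ (x ∷ y ∷ _) = just (s₇ , (x , stay) ∷ (y , stay) ∷ idle ∷ put wild ∷ [])
δ s₇ _ = nothing

transducer : Transducer 11 0 0
transducer = record { states = 8 ; start = s₀ ; δ = δ }

-- Runs of the machine

at : List Γ → List Γ → Tape Γ
at zs []       = tape zs blank []
at zs (x ∷ xs) = tape zs x xs

load≡at : ∀ xs → load blank xs ≡ at [] xs
load≡at []       = refl
load≡at (x ∷ xs) = refl

moveHead-right : ∀ zs x xs → moveHead blank right (tape zs x xs) ≡ at (x ∷ zs) xs
moveHead-right zs x []      = refl
moveHead-right zs x (_ ∷ _) = refl

output : List Point → List Γ → Tape Γ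
output k zs = tape (map point (map code k) ʳ++ zs) blank []

-- Quantifying over all that lies left of the heads lets steps be prepended to a run on the
-- remaining input, so runs are assembled from the end backwards.
record Writes (q : Fin 8) (w₁ w₂ : List Γ) (t : ℕ) (k₁ k₂ : List Point) : Set where
  field
    exec : ∀ us₁ us₂ zs₁ zs₂ → ∃ λ q′ → ∃₂ λ i₁ i₂ →
      Run blank transducer (q , at us₁ w₁ ∷ at us₂ w₂ ∷ output [] zs₁ ∷ output [] zs₂ ∷ []) t
        (q′ , i₁ ∷ i₂ ∷ output k₁ zs₁ ∷ output k₂ zs₂ ∷ [])
open Writes

writes-end : ∀ {d} → Writes s₂ [] [] 2 [] (blocks₂ {d = d} [])
writes-end .exec us₁ us₂ zs₁ zs₂ = _ , _ , _ , (refl then (refl then halted refl))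

writes-letters : ∀ {d} (a b : BitVec d) {w₁ w₂ t k₁ k₂} → Writes s₄ w₁ w₂ t k₁ k₂ →
  Writes s₄ (map bit (Vec.toList a) ++ w₁) (map bit (Vec.toList b) ++ w₂) (d * 2 + t)
    (letters in₁ a k₁) (letters in₂ b k₂)
writes-letters []      []      W = W
writes-letters (x ∷ a) (y ∷ b) W .exec us₁ us₂ zs₁ zs₂
  with _ , _ , _ , run ← writes-letters a b W .exec (bit x ∷ us₁) (bit y ∷ us₂) _ _ =
  _ , _ , _ ,
  -- The remaining inputs are not in constructor form, so the head movement is rewritten instead of
  -- computed.
  (cong₂ (λ τ₁ τ₂ → just (s₅ , τ₁ ∷ τ₂ ∷ output (in₁ (bit x) ∷ []) zs₁
                                       ∷ output (in₂ (bit y) ∷ []) zs₂ ∷ []))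
     (moveHead-right us₁ (bit x) _) (moveHead-right us₂ (bit y) _)
   then (refl then run))

writes-leave : ∀ {w₁ w₂ t k₁ k₂} → Writes s₂ w₁ w₂ t k₁ k₂ →
               Writes s₄ (sep ∷ w₁) (sep ∷ w₂) (1 + t) (leave ∷ k₁) k₂
writes-leave W .exec us₁ us₂ zs₁ zs₂
  with _ , _ , _ , run ← W .exec (sep ∷ us₁) (sep ∷ us₂) (point (code leave) ∷ zs₁) zs₂ =
  _ , _ , _ ,
  (cong₂ (λ τ₁ τ₂ → just (s₂ , τ₁ ∷ τ₂ ∷ output (leave ∷ []) zs₁ ∷ output [] zs₂ ∷ []))
     (moveHead-right us₁ sep _) (moveHead-right us₂ sep _)
   then run)

writes-enter : ∀ {d} (a : BitVec d) {w₁ w₂ t k₁ k₂} →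
  let w = map bit (Vec.toList a) ++ sep ∷ w₁ in
  Writes s₄ w w₂ t k₁ k₂ → Writes s₂ w w₂ (2 + t) (enter ∷ in₁ mark ∷ k₁) (in₂ mark ∷ k₂)
-- The split on the vector only exposes a nonblank first symbol, `sep` or a bit, so that `δ` reduces
-- at `s₂`.
writes-enter []      W .exec us₁ us₂ zs₁ zs₂ with _ , _ , _ , run ← W .exec us₁ us₂ _ _ =
  _ , _ , _ , (refl then (refl then run))
writes-enter (x ∷ a) W .exec us₁ us₂ zs₁ zs₂ with _ , _ , _ , run ← W .exec us₁ us₂ _ _ =
  _ , _ , _ , (refl then (refl then run))

-- Per block, two steps open it, each bit with its link takes two, and `leave` takes one.
time : ℕ → ℕ → ℕ
time zero    d = 2
time (suc n) d = 2 + (d * 2 + (1 + time n d))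

writes-blocks : ∀ {n d} (α β : Vec (BitVec d) n) →
  Writes s₂ (encode α) (encode β) (time n d) (blocks₁ α) (blocks₂ β)
writes-blocks {d = d} [] [] = writes-end {d}
writes-blocks (a ∷ α) (b ∷ β)
  rewrite ++-assoc (map (bit {11} {0}) (Vec.toList a)) [ sep ] (encode α)
        | ++-assoc (map (bit {11} {0}) (Vec.toList b)) [ sep ] (encode β) =
  writes-enter a (writes-letters a b (writes-leave (writes-blocks α β)))

writes-sequences : ∀ {n d} (α β : Vec (BitVec d) n) →
  Writes s₀ (encode α) (encode β) (2 + time n d)
    (List⁺.toList (sequence₁ α)) (List⁺.toList (sequence₂ β))
writes-sequences α β .exec us₁ us₂ zs₁ zs₂
  with _ , _ , _ , run ← writes-blocks α β .exec us₁ us₂ _ _ =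
  _ , _ , _ , (refl then (refl then run))

output-contains : ∀ k → Contains blank (output k []) (map point (map code k))
-- The single trailing blank is the cell under the head.
output-contains k = 0 , 1 , ʳ++-ʳ++ (map point (map code k))

constructs : ∀ {n d} (α β : Vec (BitVec d) n) →
  Constructs transducer α β (List⁺.map code (sequence₁ α)) (List⁺.map code (sequence₂ β))
    (2 + time n d)
constructs α β rewrite load≡at (encode α) | load≡at (encode β)
  with _ , _ , _ , run ← writes-sequences α β .exec [] [] [] [] =
  _ , _ , _ , _ , _ , _ , run ,
  output-contains (List⁺.toList (sequence₁ α)) , output-contains (List⁺.toList (sequence₂ β))

-- Linear bound on the running time

time-closed : ∀ n d → 2 + time n d ≡ 4 + n * (d * 2 + 3)
time-closed zero    d = refl
time-closed (suc n) d = trans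
  (shift d (time n d)) (trans (cong (d * 2 + 3 +_) (time-closed n d)) (unfold (d * 2 + 3) n))
  where
  shift : ∀ d t → 2 + (2 + (d * 2 + (1 + t))) ≡ d * 2 + 3 + (2 + t)
  shift = solve-∀
  unfold : ∀ e n → e + (4 + n * e) ≡ 4 + suc n * e
  unfold = solve-∀

time-linear : ∀ n d → 1 ≤ n → 1 ≤ d → 2 + time n d ≤ 9 * (n * d)
time-linear (suc n) (suc d) _ _ =
  subst₂ _≤_ (sym (time-closed (suc n) (suc d))) (surplus n d)
    -- This is the exact difference of the two sides; it vanishes when both vector count and
    -- dimension are 1, where 9 is attained.
    (m≤m+n _ (7 * n * d + 4 * n + 7 * d))
  where
  surplus : ∀ n d → 4 + suc n * (suc d * 2 + 3) + (7 * n * d + 4 * n + 7 * d)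
                  ≡ 9 * (suc n * suc d)
  surplus = solve-∀

lemma12 : ∃ λ (m : ℕ) → Σ (DistanceFunction (Fin m)) λ f →
    IsDistance f × ¬ TriangleInequality f ×
    (∃₂ λ (a w : ℕ) → Σ (Transducer m a w) λ M → ∃ λ (c : ℕ) →
    ∀ (n d : ℕ) (α β : Vec (BitVec d) n) →
    ∃₂ λ P₁ P₂ → ∃ λ (t : ℕ) →
    Constructs M α β P₁ P₂ t ×
    (1 ≤ n → 1 ≤ d → t ≤ c * (n * d)) ×
    (OrthogonalPair α β → IsDTWD f P₁ P₂ 0) ×
    (¬ OrthogonalPair α β → IsDTWD f P₁ P₂ 1))
lemma12 =
  11 , dist , dist-isDistance , ¬dist-triangle , 0 , 0 , transducer , 9 , λ n d α β →
  List⁺.map code (sequence₁ α) , List⁺.map code (sequence₂ β) , 2 + time n d ,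
  constructs α β , time-linear n d ,
  (λ p → map-IsDTWD code dist-code (orthogonal⇒DTWD-0 α β p)) ,
  (λ ¬p → map-IsDTWD code dist-code (¬orthogonal⇒DTWD-1 α β ¬p))
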